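{- Let $\Delta\geq 1$ be an integer and let $G$ be a $\Delta$-regular graph. Then $$\gamma(G)\leq \left(1+\frac{2(\Delta-1)}{\Delta 2^{\Delta}}\right)\gamma_e(G).$$
   Context: All graphs are finite, simple, and undirected. A set $D\subseteq V(G)$ is a dominating set in $G$ if every vertex in $V(G)\setminus D$ has a neighbor in $D$; the domination number $\gamma(G)$ is the minimum cardinality of a dominating set in $G$. A matching in $G$ is a set of pairwise disjoint edges of $G$; it is maximal if it is maximal with respect to inclusion among matchings in $G$ (equivalently, the set of vertices not incident with any edge of the matching is independent). The edge domination number $\gamma_e(G)$ is the minimum size (number of edges) of a maximal matching in $G$. A graph is $\Delta$-regular if every vertex has exactly $\Delta$ neighbors. -}

module Defs where

open import Level using (Level; 0ℓ)
open import Data.Empty using (⊥-elim)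
open import Data.Nat.Base using (ℕ; NonZero; _≤_; _<_; _*_; _^_)
open import Data.Nat.Properties using (_<?_; ≮⇒≥; m*n≢0; m^n≢0)
open import Data.Nat.Induction using (<-wellFounded)
import Data.Bool.Properties as Bool
open import Data.Fin.Base using (Fin)
import Data.Fin.Base as Fin
import Data.Fin.Properties as Fin
open import Data.Fin.Subset using (Subset; _∈_; _∉_; _⊆_; _⊃_; ⊤; ⊥; ∣_∣)
open import Data.Fin.Subset.Properties
  using (anySubset?; _∈?_; _⊆?_; ∈⊤; ∉⊥; ⊆-antisym)
open import Data.Fin.Subset.Induction using (⊃-wellFounded)
open import Data.List.Base using (List; length; lookup; filter; allFin; cartesianProduct)
import Data.List.Membership.Propositional as List
open import Data.List.Membership.Propositional.Properties
  using (∈-filter⁺; ∈-filter⁻; ∈-cartesianProduct⁺; ∈-allFin)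
open import Data.List.Relation.Unary.Unique.Propositional using (Unique)
import Data.List.Relation.Unary.Unique.Propositional.Properties as Unique
open import Data.Product.Base using (∃; _×_; _,_; proj₁; proj₂)
open import Data.Sum.Base using (_⊎_)
open import Data.Vec.Base using (tabulate)
open import Data.Vec.Properties using (≡-dec)
open import Function.Base using (_∘_; it)
open import Function.Bundles using (_⇔_; mk⇔)
open import Induction.WellFounded using (Acc; acc)
open import Relation.Binary.Core using (Rel)
open import Relation.Binary.Definitions using (Decidable; Symmetric; Irreflexive)
open import Relation.Binary.PropositionalEquality using (_≡_; _≢_)
open import Relation.Nullary.Decidable
  using (Dec; yes; no; does; ¬?; map′; decidable-stable; _×-dec_; _⊎-dec_; _→-dec_)
open import Relation.Nullary.Negation using (¬_)
import Relation.Unary as Unary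

private
  variable
    ℓ : Level
    m n : ℕ

-- Finite simple undirected graphs on the vertex set Fin n.
record Graph (n : ℕ) : Set₁ where
  infix 4 _~_ _~?_
  field
    _~_      : Rel (Fin n) 0ℓ
    _~?_     : Decidable _~_
    ~-sym    : Symmetric _~_
    ~-irrefl : Irreflexive _≡_ _~_

allSubsets? : {P : Unary.Pred (Subset m) ℓ} → Unary.Decidable P → Dec (∀ p → P p)
allSubsets? P? = map′
  (λ ¬∃ p → decidable-stable (P? p) (λ ¬Pp → ¬∃ (p , ¬Pp)))
  (λ ∀P (p , ¬Pp) → ¬Pp (∀P p))
  (¬? (anySubset? (λ p → ¬? (P? p))))

minimumSubset : {P : Unary.Pred (Subset m) ℓ} → Unary.Decidable P → ∃ P →
                ∃ λ p → P p × (∀ q → P q → ∣ p ∣ ≤ ∣ q ∣)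
minimumSubset {P = P} P? (p₀ , Pp₀) = descend p₀ Pp₀ (<-wellFounded ∣ p₀ ∣)
  where
  descend : ∀ p → P p → Acc _<_ ∣ p ∣ →
            ∃ λ p → P p × (∀ q → P q → ∣ p ∣ ≤ ∣ q ∣)
  descend p Pp (acc rec) with anySubset? (λ q → P? q ×-dec (∣ q ∣ <? ∣ p ∣))
  ... | yes (q , Pq , q<p) = descend q Pq (rec q<p)
  ... | no ¬smaller        = p , Pp , λ q Pq → ≮⇒≥ (λ q<p → ¬smaller (q , Pq , q<p))

module _ (G : Graph n) where
  open Graph G

  neighbourhood : Fin n → Subset n
  neighbourhood v = tabulate (λ u → does (v ~? u))

  degree : Fin n → ℕ
  degree v = ∣ neighbourhood v ∣

  Regular : ℕ → Set
  Regular Δ = ∀ v → degree v ≡ Δ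

  Dominating : Subset n → Set
  Dominating D = ∀ v → v ∉ D → ∃ λ u → u ∈ D × v ~ u

  dominating? : Unary.Decidable Dominating
  dominating? D = Fin.all? λ v → ¬? (v ∈? D) →-dec Fin.any? λ u → (u ∈? D) ×-dec (v ~? u)

  minimumDominating : ∃ λ D → Dominating D × (∀ D′ → Dominating D′ → ∣ D ∣ ≤ ∣ D′ ∣)
  minimumDominating = minimumSubset dominating? (⊤ , λ v v∉⊤ → ⊥-elim (v∉⊤ ∈⊤))

  γ : ℕ
  γ = ∣ proj₁ minimumDominating ∣

  -- An edge {u , v} is represented by the pair (u , v) with u < v, and a set
  -- of edges by the set of positions its members have in the list `edges`.
  IsEdge : Fin n × Fin n → Set
  IsEdge (u , v) = u Fin.< v × u ~ v

  isEdge? : Unary.Decidable IsEdge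
  isEdge? (u , v) = (u Fin.<? v) ×-dec (u ~? v)

  edges : List (Fin n × Fin n)
  edges = filter isEdge? (cartesianProduct (allFin n) (allFin n))

  ∈-edges⇔ : ∀ {e} → e List.∈ edges ⇔ IsEdge e
  ∈-edges⇔ = mk⇔
    (proj₂ ∘ ∈-filter⁻ isEdge? {xs = cartesianProduct (allFin n) (allFin n)})
    (∈-filter⁺ isEdge? (∈-cartesianProduct⁺ (∈-allFin _) (∈-allFin _)))

  edges-unique : Unique edges
  edges-unique =
    Unique.filter⁺ isEdge? (Unique.cartesianProduct⁺ (Unique.allFin⁺ n) (Unique.allFin⁺ n))

  Edge : Set
  Edge = Fin (length edges)

  EdgeSet : Set
  EdgeSet = Subset (length edges)

  source target : Edge → Fin n
  source e = proj₁ (lookup edges e)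
  target e = proj₂ (lookup edges e)

  Incident : Fin n → Edge → Set
  Incident v e = v ≡ source e ⊎ v ≡ target e

  incident? : Decidable Incident
  incident? v e = (v Fin.≟ source e) ⊎-dec (v Fin.≟ target e)

  Disjoint : Edge → Edge → Set
  Disjoint e f = ∀ v → ¬ (Incident v e × Incident v f)

  disjoint? : Decidable Disjoint
  disjoint? e f = Fin.all? λ v → ¬? (incident? v e ×-dec incident? v f)

  Matching : EdgeSet → Set
  Matching M = ∀ e f → e ∈ M → f ∈ M → e ≢ f → Disjoint e f

  matching? : Unary.Decidable Matching
  matching? M = Fin.all? λ e → Fin.all? λ f →
    (e ∈? M) →-dec (f ∈? M) →-dec ¬? (e Fin.≟ f) →-dec disjoint? e f

  MaximalMatching : EdgeSet → Set
  MaximalMatching M = Matching M × (∀ M′ → Matching M′ → M ⊆ M′ → M ≡ M′)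

  maximalMatching? : Unary.Decidable MaximalMatching
  maximalMatching? M = matching? M ×-dec allSubsets? λ M′ →
    matching? M′ →-dec (M ⊆? M′) →-dec ≡-dec Bool._≟_ M M′

  maximalMatching : ∃ MaximalMatching
  maximalMatching = extend ⊥ (λ e f e∈⊥ → ⊥-elim (∉⊥ e∈⊥)) (⊃-wellFounded ⊥)
    where
    extend : ∀ M → Matching M → Acc _⊃_ M → ∃ MaximalMatching
    extend M isM (acc rec)
      with anySubset? (λ M′ → matching? M′ ×-dec ((M ⊆? M′) ×-dec
             Fin.any? λ e → (e ∈? M′) ×-dec ¬? (e ∈? M)))
    ... | yes (M′ , isM′ , M⊂M′) = extend M′ isM′ (rec M⊂M′)
    ... | no ¬larger = M , isM , λ M′ isM′ M⊆M′ → ⊆-antisym M⊆M′ λ {e} e∈M′ →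
          decidable-stable (e ∈? M) λ e∉M → ¬larger (M′ , isM′ , M⊆M′ , e , e∈M′ , e∉M)

  minimumMaximalMatching :
    ∃ λ M → MaximalMatching M × (∀ M′ → MaximalMatching M′ → ∣ M ∣ ≤ ∣ M′ ∣)
  minimumMaximalMatching = minimumSubset maximalMatching? maximalMatching

  γₑ : ℕ
  γₑ = ∣ proj₁ minimumMaximalMatching ∣

instance
  Δ*2^Δ≢0 : ∀ {Δ} .{{_ : NonZero Δ}} → NonZero (Δ * 2 ^ Δ)
  Δ*2^Δ≢0 {Δ} = m*n≢0 Δ (2 ^ Δ) {{it}} {{m^n≢0 2 Δ}}

{-# OPTIONS --safe #-}

-- Pick one endpoint of every edge of a minimum maximal matching M at random.
-- This dominates all covered vertices. The set U of uncovered vertices is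
-- independent, so u ∈ U has Δ neighbours covered by M and stays undominated
-- with probability at most 2^-Δ (probability 0 if it sees both ends of an
-- edge). Adding the undominated vertices gives a dominating set of expected
-- size at most |M| + |U| / 2^Δ, and counting the edges between U and the 2|M|
-- covered vertices, each of which has a neighbour outside U, gives
-- Δ|U| ≤ 2(Δ - 1)|M|. The random choice is derandomised by the method of
-- conditional expectations.
module Submission where

open import Defs
open import Data.Nat.Base using (ℕ; NonZero; _∸_; _^_) renaming (_*_ to _*ℕ_)
open import Data.Integer.Base using (+_)
open import Data.Rational.Base using (_≤_; _+_; _*_; _/_; 1ℚ)

open import Data.Bool.Base using (if_then_else_)
import Data.Integer.Base as ℤ
import Data.Integer.Properties as ℤ
open import Data.Nat.Base using (zero; suc; z≤n; s≤s) renaming (_+_ to _+ℕ_; _≤_ to _≤ℕ_)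
import Data.Nat.Properties as ℕ
open import Data.Nat.Tactic.RingSolver using (solve-∀)
open import Data.Rational.Base using (toℚᵘ)
import Data.Rational.Properties as ℚ
import Data.Rational.Unnormalised.Base as ℚᵘ
import Data.Rational.Unnormalised.Properties as ℚᵘ
open import Data.Fin.Base as Fin using (Fin; zero; suc)
import Data.Fin.Properties as Fin
open import Data.Fin.Subset using (Subset; inside; outside; _∈_; _∉_; _∪_; ⁅_⁆; ⊥; ∣_∣)
open import Data.Fin.Subset.Properties
  using (_∈?_; ∣⊥∣≡0; ∣⁅x⁆∣≡1; x∈⁅x⁆; x∈⁅y⁆⇒x≡y; p⊆p∪q; q⊆p∪q; x∈p∪q⁻)
open import Data.List.Base using (length)
open import Data.List.Membership.Propositional.Properties using (∈-lookup)
import Data.List.Relation.Unary.Any as Any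
open import Data.List.Relation.Unary.Any.Properties using (lookup-index)
open import Data.Product.Base using (∃; _×_; _,_; proj₁; proj₂)
open import Data.Sum.Base as Sum using (_⊎_; inj₁; inj₂)
open import Data.Vec.Base using ([]; _∷_; there; tabulate)
open import Data.Vec.Properties using (lookup∘tabulate; []=⇒lookup; lookup⇒[]=)
open import Data.Vec.Functional using (Vector)
open import Function.Base using (_∘_)
open import Function.Bundles using (module Equivalence)
open import Level using (Level)
open import Relation.Binary.Core using (Rel)
open import Relation.Binary.Definitions using (Decidable; tri<; tri≈; tri>)
open import Relation.Binary.PropositionalEquality
open import Relation.Nullary.Decidable
  using (Dec; yes; no; does; ¬?; _×-dec_; dec-true; dec-false)
open import Relation.Nullary.Negation using (¬_; contradiction)
open import Relation.Unary as Unary using (Pred)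

open import Algebra.Properties.Semiring.Sum ℕ.+-*-semiring

private
  variable
    a ℓ : Level
    A B : Set a
    m n : ℕ

-- Iverson brackets and finite sums of natural numbers.

⟦_⟧ : Dec A → ℕ
⟦ A? ⟧ = if does A? then 1 else 0

⟦⟧-true : (A? : Dec A) → A → ⟦ A? ⟧ ≡ 1
⟦⟧-true A? x = cong (if_then 1 else 0) (dec-true A? x)

⟦⟧-false : (A? : Dec A) → ¬ A → ⟦ A? ⟧ ≡ 0
⟦⟧-false A? ¬x = cong (if_then 1 else 0) (dec-false A? ¬x)

⟦⟧-mono : (A? : Dec A) (B? : Dec B) → (A → B) → ⟦ A? ⟧ ≤ℕ ⟦ B? ⟧
⟦⟧-mono (no _)  B? f = z≤n
⟦⟧-mono (yes x) B? f = ℕ.≤-reflexive (sym (⟦⟧-true B? (f x)))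

⟦⟧≤1 : (A? : Dec A) → ⟦ A? ⟧ ≤ℕ 1
⟦⟧≤1 (no _)  = z≤n
⟦⟧≤1 (yes _) = ℕ.≤-refl

⟦⟧-cong : (A? : Dec A) (B? : Dec B) → (A → B) → (B → A) → ⟦ A? ⟧ ≡ ⟦ B? ⟧
⟦⟧-cong A? B? f g = ℕ.≤-antisym (⟦⟧-mono A? B? f) (⟦⟧-mono B? A? g)

sum-mono-≤ : {f g : Vector ℕ n} → (∀ i → f i ≤ℕ g i) → sum f ≤ℕ sum g
sum-mono-≤ {zero}  f≤g = z≤n
sum-mono-≤ {suc n} f≤g = ℕ.+-mono-≤ (f≤g zero) (sum-mono-≤ (f≤g ∘ suc))

sum-zero : {f : Vector ℕ n} → (∀ i → f i ≡ 0) → sum f ≡ 0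
sum-zero {n} f≡0 = trans (sum-cong-≗ f≡0) (sum-replicate-zero n)

sum-single : (f : Vector ℕ n) (i : Fin n) → (∀ j → j ≢ i → f j ≡ 0) → sum f ≡ f i
sum-single f zero    f≡0 =
  trans (cong (f zero +ℕ_) (sum-zero (λ j → f≡0 (suc j) λ ()))) (ℕ.+-identityʳ _)
sum-single f (suc i) f≡0 =
  cong₂ _+ℕ_ (f≡0 zero λ ())
    (sum-single (f ∘ suc) i (λ j j≢i → f≡0 (suc j) (j≢i ∘ Fin.suc-injective)))

sum-indicator-single : (y : Fin n) (f : Vector ℕ n) → ∑[ x < n ] (⟦ x Fin.≟ y ⟧ *ℕ f x) ≡ f y
sum-indicator-single y f = begin
  sum (λ x → ⟦ x Fin.≟ y ⟧ *ℕ f x) ≡⟨ sum-single _ y (λ x x≢y → cong (_*ℕ f x) (⟦⟧-false (x Fin.≟ y) x≢y)) ⟩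
  ⟦ y Fin.≟ y ⟧ *ℕ f y             ≡⟨ cong (_*ℕ f y) (⟦⟧-true (y Fin.≟ y) refl) ⟩
  1 *ℕ f y                         ≡⟨ ℕ.*-identityˡ _ ⟩
  f y                              ∎
  where open ≡-Reasoning

-- Sizes of subsets.

∣p∣≡∑ : (p : Subset n) → ∣ p ∣ ≡ ∑[ i < n ] ⟦ i ∈? p ⟧
∣p∣≡∑ []            = refl
∣p∣≡∑ (inside  ∷ p) = cong suc (∣p∣≡∑ p)
∣p∣≡∑ (outside ∷ p) = ∣p∣≡∑ p

∣p∪q∣≤∣p∣+∣q∣ : (p q : Subset n) → ∣ p ∪ q ∣ ≤ℕ ∣ p ∣ +ℕ ∣ q ∣
∣p∪q∣≤∣p∣+∣q∣ []            []            = z≤n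
∣p∪q∣≤∣p∣+∣q∣ (outside ∷ p) (outside ∷ q) = ∣p∪q∣≤∣p∣+∣q∣ p q
∣p∪q∣≤∣p∣+∣q∣ (outside ∷ p) (inside  ∷ q) =
  ℕ.≤-trans (s≤s (∣p∪q∣≤∣p∣+∣q∣ p q)) (ℕ.≤-reflexive (sym (ℕ.+-suc ∣ p ∣ ∣ q ∣)))
∣p∪q∣≤∣p∣+∣q∣ (inside  ∷ p) (outside ∷ q) = s≤s (∣p∪q∣≤∣p∣+∣q∣ p q)
∣p∪q∣≤∣p∣+∣q∣ (inside  ∷ p) (inside  ∷ q) =
  s≤s (ℕ.≤-trans (∣p∪q∣≤∣p∣+∣q∣ p q) (ℕ.+-monoʳ-≤ ∣ p ∣ (ℕ.n≤1+n ∣ q ∣)))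

module _ {P : Pred (Fin n) ℓ} (P? : Unary.Decidable P) where

  comprehension : Subset n
  comprehension = tabulate (does ∘ P?)

  ∈-comprehension⁺ : ∀ {x} → P x → x ∈ comprehension
  ∈-comprehension⁺ {x} Px =
    lookup⇒[]= x comprehension (trans (lookup∘tabulate (does ∘ P?) x) (dec-true (P? x) Px))

  ∈-comprehension⁻ : ∀ {x} → x ∈ comprehension → P x
  ∈-comprehension⁻ {x} x∈ with P? x | trans (sym (lookup∘tabulate (does ∘ P?) x)) ([]=⇒lookup x∈)
  ... | yes Px | _ = Px

  ∣comprehension∣≡∑ : ∣ comprehension ∣ ≡ ∑[ i < n ] ⟦ P? i ⟧
  ∣comprehension∣≡∑ = trans (∣p∣≡∑ comprehension)
    (sum-cong-≗ λ i → ⟦⟧-cong (i ∈? comprehension) (P? i) ∈-comprehension⁻ ∈-comprehension⁺)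

-- The method of conditional expectations. Starting from weight 1, once some
-- edges are decided the weight of u is 0 if u is dominated and otherwise 2 to
-- the number of its neighbours among their endpoints: up to the constant factor
-- 2 ^ exposure, this bounds the probability that u stays undominated.
module _ {_~_ : Rel (Fin n) ℓ} (_~?_ : Decidable _~_) where

  -- Counting edge by edge suits recursion on `M`; for a matching, `exposure-uncovered` turns this
  -- count into a degree.
  exposure : Subset m → (s t : Fin m → Fin n) → Fin n → ℕ
  exposure {m} M s t u = ∑[ e < m ] (⟦ e ∈? M ⟧ *ℕ (⟦ u ~? s e ⟧ +ℕ ⟦ u ~? t e ⟧))

  Undominated : (C X : Subset n) → Set ℓ
  Undominated C X = ∀ u x → u ∈ X → x ∈ C → ¬ u ~ x

  -- Here `p` is chosen and `q` rejected. Neighbours of `p` are now dominated and lose their weight;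
  -- a vertex adjacent to `q` alone has lost one chance of being dominated, so its weight doubles.
  reweigh : (p q : Fin n) → Vector ℕ n → Vector ℕ n
  reweigh p q w u = w u *ℕ ((1 ∸ ⟦ u ~? p ⟧) *ℕ 2 ^ ⟦ u ~? q ⟧)

  -- The factors of the two choices are 0 + 0 for a common neighbour of `p` and `q`, 0 and 2 for a
  -- neighbour of just one, and 1 + 1 otherwise. So a fair choice does not raise the expected
  -- weight.
  reweigh-average : ∀ p q w u → reweigh p q w u +ℕ reweigh q p w u ≤ℕ 2 *ℕ w u
  reweigh-average p q w u = begin
    reweigh p q w u +ℕ reweigh q p w u ≡⟨ sym (ℕ.*-distribˡ-+ (w u) _ _) ⟩
    w u *ℕ _                           ≤⟨ ℕ.*-monoʳ-≤ (w u) (bound (u ~? p) (u ~? q)) ⟩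
    w u *ℕ 2                           ≡⟨ ℕ.*-comm (w u) 2 ⟩
    2 *ℕ w u                           ∎
    where
    open ℕ.≤-Reasoning
    bound : (A? : Dec A) (B? : Dec B) →
            (1 ∸ ⟦ A? ⟧) *ℕ 2 ^ ⟦ B? ⟧ +ℕ (1 ∸ ⟦ B? ⟧) *ℕ 2 ^ ⟦ A? ⟧ ≤ℕ 2
    bound (yes _) (yes _) = z≤n
    bound (yes _) (no  _) = ℕ.≤-refl
    bound (no  _) (yes _) = ℕ.≤-refl
    bound (no  _) (no  _) = ℕ.≤-refl

  -- The smaller of two numbers is at most their average. This replaces the random choice by a
  -- definite one.
  reweigh-decreasing : ∀ p q w →
    sum (reweigh p q w) ≤ℕ sum w ⊎ sum (reweigh q p w) ≤ℕ sum w
  reweigh-decreasing p q w = Sum.map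
    (λ x≤y → halve (ℕ.≤-trans (ℕ.+-monoʳ-≤ _ x≤y) total))
    (λ y≤x → halve (ℕ.≤-trans (ℕ.+-monoˡ-≤ _ y≤x) total))
    (ℕ.≤-total (sum (reweigh p q w)) (sum (reweigh q p w)))
    where
    open ℕ.≤-Reasoning
    total : sum (reweigh p q w) +ℕ sum (reweigh q p w) ≤ℕ 2 *ℕ sum w
    total = begin
      sum (reweigh p q w) +ℕ sum (reweigh q p w)         ≡⟨ sym (∑-distrib-+ (reweigh p q w) (reweigh q p w)) ⟩
      sum (λ u → reweigh p q w u +ℕ reweigh q p w u)     ≤⟨ sum-mono-≤ (reweigh-average p q w) ⟩
      sum (λ u → 2 *ℕ w u)                               ≡⟨ sym (*-distribˡ-sum 2 w) ⟩
      2 *ℕ sum w                                         ∎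
    halve : ∀ {x y} → x +ℕ x ≤ℕ 2 *ℕ y → x ≤ℕ y
    halve {x} {y} x+x≤2y = ℕ.*-cancelˡ-≤ 2
      (ℕ.≤-trans (ℕ.≤-reflexive (cong (x +ℕ_) (ℕ.+-identityʳ x))) x+x≤2y)

  -- With `d` the exposure to the undecided edges, this is the weight that `X` carries in the end if
  -- it stays undominated: each remaining adjacent endpoint is then rejected and doubles the weight.
  undominated-weight : Subset n → Vector ℕ n → Vector ℕ n → ℕ
  undominated-weight X w d = ∑[ u < n ] (⟦ u ∈? X ⟧ *ℕ (w u *ℕ 2 ^ d u))

  -- On `X` the choice of `p` kills no weight, so it only moves the factor for `q` out of the
  -- exponent into the weight.
  undominated-weight-reweigh : ∀ {X} p q w d → (∀ u → u ∈ X → ¬ u ~ p) →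
    undominated-weight X w (λ u → ⟦ u ~? p ⟧ +ℕ ⟦ u ~? q ⟧ +ℕ d u) ≡
    undominated-weight X (reweigh p q w) d
  undominated-weight-reweigh {X} p q w d X≁p = sum-cong-≗ λ u → pointwise u (u ∈? X)
    where
    open ≡-Reasoning
    pointwise : ∀ u (u∈?X : Dec (u ∈ X)) →
      ⟦ u∈?X ⟧ *ℕ (w u *ℕ 2 ^ (⟦ u ~? p ⟧ +ℕ ⟦ u ~? q ⟧ +ℕ d u)) ≡
      ⟦ u∈?X ⟧ *ℕ (reweigh p q w u *ℕ 2 ^ d u)
    pointwise u (no _)    = refl
    pointwise u (yes u∈X) rewrite ⟦⟧-false (u ~? p) (X≁p u u∈X) = cong (1 *ℕ_) (begin
      w u *ℕ 2 ^ (⟦ u ~? q ⟧ +ℕ d u)              ≡⟨ cong (w u *ℕ_) (ℕ.^-distribˡ-+-* 2 ⟦ u ~? q ⟧ (d u)) ⟩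
      w u *ℕ (2 ^ ⟦ u ~? q ⟧ *ℕ 2 ^ d u)          ≡⟨ sym (ℕ.*-assoc (w u) _ _) ⟩
      w u *ℕ 2 ^ ⟦ u ~? q ⟧ *ℕ 2 ^ d u            ≡⟨ cong (λ z → w u *ℕ z *ℕ 2 ^ d u) (sym (ℕ.*-identityˡ _)) ⟩
      w u *ℕ (1 *ℕ 2 ^ ⟦ u ~? q ⟧) *ℕ 2 ^ d u     ∎)

  -- Induction on `M` with `w` general, since each choice changes the weights. No choice raises the
  -- total, so the final weight of an undominated set is at most the initial total. `X` comes after
  -- `C` because it will be defined from `C`.
  choose-endpoints : (M : Subset m) (s t : Fin m → Fin n) (w : Vector ℕ n) →
    ∃ λ C → ∣ C ∣ ≤ℕ ∣ M ∣
          × (∀ e → e ∈ M → s e ∈ C ⊎ t e ∈ C)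
          × (∀ X → Undominated C X → undominated-weight X w (exposure M s t) ≤ℕ sum w)
  choose-endpoints [] s t w =
    ⊥ , ℕ.≤-reflexive (∣⊥∣≡0 n) , (λ ()) , λ X _ → sum-mono-≤ λ u → begin
      ⟦ u ∈? X ⟧ *ℕ (w u *ℕ 1) ≤⟨ ℕ.*-monoˡ-≤ (w u *ℕ 1) (⟦⟧≤1 (u ∈? X)) ⟩
      1 *ℕ (w u *ℕ 1)          ≡⟨ trans (ℕ.*-identityˡ _) (ℕ.*-identityʳ _) ⟩
      w u                      ∎
    where open ℕ.≤-Reasoning
  choose-endpoints (outside ∷ M) s t w
    with C , ∣C∣≤∣M∣ , hits , bound ← choose-endpoints M (s ∘ suc) (t ∘ suc) w =
    C , ∣C∣≤∣M∣ , (λ { (suc e) (there e∈M) → hits e e∈M }) , bound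
  choose-endpoints (inside ∷ M) s t w =
    Sum.[ first , second ]′ (reweigh-decreasing (s zero) (t zero) w)
    where
    d : Vector ℕ n
    d = exposure M (s ∘ suc) (t ∘ suc)

    select : ∀ p q → sum (reweigh p q w) ≤ℕ sum w →
      ∃ λ C → ∣ C ∣ ≤ℕ suc ∣ M ∣
            × p ∈ C
            × (∀ e → e ∈ M → s (suc e) ∈ C ⊎ t (suc e) ∈ C)
            × (∀ X → Undominated C X →
               undominated-weight X w (λ u → ⟦ u ~? p ⟧ +ℕ ⟦ u ~? q ⟧ +ℕ d u) ≤ℕ sum w)
    select p q decreasing
      with C , ∣C∣≤∣M∣ , hits , bound ← choose-endpoints M (s ∘ suc) (t ∘ suc) (reweigh p q w) =
      ⁅ p ⁆ ∪ C ,
      ℕ.≤-trans (∣p∪q∣≤∣p∣+∣q∣ ⁅ p ⁆ C) (ℕ.+-mono-≤ (ℕ.≤-reflexive (∣⁅x⁆∣≡1 p)) ∣C∣≤∣M∣) ,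
      p⊆p∪q C (x∈⁅x⁆ p) ,
      (λ e e∈M → Sum.map (q⊆p∪q ⁅ p ⁆ C) (q⊆p∪q ⁅ p ⁆ C) (hits e e∈M)) ,
      -- A set undominated by `⁅ p ⁆ ∪ C` has no neighbour of `p`, as the reweighing identity
      -- requires, and no neighbour of `C`, as the induction hypothesis requires.
      λ X undom → begin
        undominated-weight X w (λ u → ⟦ u ~? p ⟧ +ℕ ⟦ u ~? q ⟧ +ℕ d u)
          ≡⟨ undominated-weight-reweigh p q w d (λ u u∈X → undom u p u∈X (p⊆p∪q C (x∈⁅x⁆ p))) ⟩
        undominated-weight X (reweigh p q w) d
          ≤⟨ bound X (λ u x u∈X → undom u x u∈X ∘ q⊆p∪q ⁅ p ⁆ C) ⟩
        sum (reweigh p q w)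
          ≤⟨ decreasing ⟩
        sum w ∎
      where open ℕ.≤-Reasoning

    exposure-∷ : ∀ u → exposure (inside ∷ M) s t u ≡ ⟦ u ~? s zero ⟧ +ℕ ⟦ u ~? t zero ⟧ +ℕ d u
    exposure-∷ u = cong (_+ℕ d u) (ℕ.*-identityˡ _)

    undominated-weight-cong : ∀ X {d d′ : Vector ℕ n} → d ≗ d′ →
      undominated-weight X w d ≡ undominated-weight X w d′
    undominated-weight-cong X d≗d′ =
      sum-cong-≗ λ u → cong (λ k → ⟦ u ∈? X ⟧ *ℕ (w u *ℕ 2 ^ k)) (d≗d′ u)

    Goal : Set ℓ
    Goal = ∃ λ C → ∣ C ∣ ≤ℕ suc ∣ M ∣
          × (∀ e → e ∈ inside ∷ M → s e ∈ C ⊎ t e ∈ C)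
          × (∀ X → Undominated C X → undominated-weight X w (exposure (inside ∷ M) s t) ≤ℕ sum w)

    first : sum (reweigh (s zero) (t zero) w) ≤ℕ sum w → Goal
    first decreasing with C , ∣C∣≤ , p∈C , hits , bound ← select (s zero) (t zero) decreasing =
      C , ∣C∣≤ ,
      (λ { zero _ → inj₁ p∈C ; (suc e) (there e∈M) → hits e e∈M }) ,
      λ X undom → ℕ.≤-trans (ℕ.≤-reflexive (undominated-weight-cong X exposure-∷)) (bound X undom)

    second : sum (reweigh (t zero) (s zero) w) ≤ℕ sum w → Goal
    second decreasing with C , ∣C∣≤ , p∈C , hits , bound ← select (t zero) (s zero) decreasing =
      C , ∣C∣≤ ,
      (λ { zero _ → inj₂ p∈C ; (suc e) (there e∈M) → hits e e∈M }) ,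
      λ X undom → ℕ.≤-trans
        (ℕ.≤-reflexive (undominated-weight-cong X λ u →
          trans (exposure-∷ u) (cong (_+ℕ d u) (ℕ.+-comm ⟦ u ~? s zero ⟧ _))))
        (bound X undom)

-- Edges, covered vertices and maximal matchings.

module _ (G : Graph n) where
  open Graph G

  source<target : (e : Edge G) → source G e Fin.< target G e
  source<target e = proj₁ (Equivalence.to (∈-edges⇔ G) (∈-lookup e))

  source≢target : (e : Edge G) → source G e ≢ target G e
  source≢target e = Fin.<⇒≢ (source<target e)

  source~target : (e : Edge G) → source G e ~ target G e
  source~target e = proj₂ (Equivalence.to (∈-edges⇔ G) (∈-lookup e))

  -- Edges are stored with the smaller end first, hence the comparison of `u` and `v`. The last
  -- component will show that this edge is disjoint from a matching that covers neither end.
  edge-between : ∀ {u v} → u ~ v → ∃ λ e → Incident G u e × Incident G v e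
                                        × (∀ x → Incident G x e → x ≡ u ⊎ x ≡ v)
  edge-between {u} {v} u~v with Fin.<-cmp u v
  ... | tri≈ _ u≡v _ = contradiction u~v (~-irrefl u≡v)
  ... | tri< u<v _ _ = Any.index uv∈ , inj₁ (cong proj₁ eq) , inj₂ (cong proj₂ eq) ,
        λ x → Sum.map (λ x≡ → trans x≡ (sym (cong proj₁ eq))) (λ x≡ → trans x≡ (sym (cong proj₂ eq)))
    where
    uv∈ = Equivalence.from (∈-edges⇔ G) (u<v , u~v)
    eq  = lookup-index uv∈
  ... | tri> _ _ v<u = Any.index vu∈ , inj₂ (cong proj₂ eq) , inj₁ (cong proj₁ eq) ,
        λ x → Sum.swap ∘ Sum.map (λ x≡ → trans x≡ (sym (cong proj₁ eq))) (λ x≡ → trans x≡ (sym (cong proj₂ eq)))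
    where
    vu∈ = Equivalence.from (∈-edges⇔ G) (v<u , ~-sym u~v)
    eq  = lookup-index vu∈

  γ-minimum : ∀ D → Dominating G D → γ G ≤ℕ ∣ D ∣
  γ-minimum = proj₂ (proj₂ (minimumDominating G))

  degree≡∑ : ∀ v → degree G v ≡ ∑[ u < n ] ⟦ v ~? u ⟧
  degree≡∑ v = ∣comprehension∣≡∑ (v ~?_)

  Covered : EdgeSet G → Fin n → Set
  Covered M v = ∃ λ e → e ∈ M × Incident G v e

  covered? : (M : EdgeSet G) → Unary.Decidable (Covered M)
  covered? M v = Fin.any? λ e → (e ∈? M) ×-dec incident? G v e

  uncovered : EdgeSet G → Subset n
  uncovered M = comprehension (λ v → ¬? (covered? M v))

  -- This covered neighbour is what lowers the count of uncovered neighbours from `Δ` to `Δ ∸ 1`.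
  covered-partner : ∀ {M v} → Covered M v → ∃ λ y → Covered M y × v ~ y
  covered-partner {v = v} (e , e∈M , inj₁ v≡) =
    target G e , (e , e∈M , inj₂ refl) , subst (_~ target G e) (sym v≡) (source~target e)
  covered-partner {v = v} (e , e∈M , inj₂ v≡) =
    source G e , (e , e∈M , inj₁ refl) , subst (_~ source G e) (sym v≡) (~-sym (source~target e))

  -- If both ends were uncovered, adding the edge `e` between them would give a matching containing
  -- `M`. By maximality it equals `M`, so `e` lies in `M` and covers `u` after all.
  maximal⇒uncovered-independent : ∀ {M} → MaximalMatching G M →
    ∀ {u v} → u ~ v → ¬ Covered M u → Covered M v
  maximal⇒uncovered-independent {M} (matching , maximal) {u} {v} u~v ¬u with covered? M v
  ... | yes v-covered = v-covered
  ... | no ¬v with e , ue , ve , only ← edge-between u~v =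
    contradiction (e , subst (e ∈_) (sym M≡M+e) (q⊆p∪q M ⁅ e ⁆ (x∈⁅x⁆ e)) , ue) ¬u
    where
    fresh : ∀ f → f ∈ M → Disjoint G f e
    fresh f f∈M x (xf , xe) with only x xe
    ... | inj₁ refl = ¬u (f , f∈M , xf)
    ... | inj₂ refl = ¬v (f , f∈M , xf)

    matching′ : Matching G (M ∪ ⁅ e ⁆)
    matching′ f g f∈ g∈ f≢g with x∈p∪q⁻ M ⁅ e ⁆ f∈ | x∈p∪q⁻ M ⁅ e ⁆ g∈
    ... | inj₁ f∈M | inj₁ g∈M = matching f g f∈M g∈M f≢g
    ... | inj₁ f∈M | inj₂ g∈e rewrite x∈⁅y⁆⇒x≡y e g∈e = fresh f f∈M
    ... | inj₂ f∈e | inj₁ g∈M rewrite x∈⁅y⁆⇒x≡y e f∈e = λ x (xe , xg) → fresh g g∈M x (xg , xe)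
    ... | inj₂ f∈e | inj₂ g∈e =
      contradiction (trans (x∈⁅y⁆⇒x≡y e f∈e) (sym (x∈⁅y⁆⇒x≡y e g∈e))) f≢g

    M≡M+e : M ≡ M ∪ ⁅ e ⁆
    M≡M+e = maximal (M ∪ ⁅ e ⁆) matching′ (p⊆p∪q ⁅ e ⁆)

  -- Sums over the vertices covered by a matching.

  incident≡ends : ∀ v e → ⟦ v Fin.≟ source G e ⟧ +ℕ ⟦ v Fin.≟ target G e ⟧ ≡ ⟦ incident? G v e ⟧
  incident≡ends v e with v Fin.≟ source G e | v Fin.≟ target G e
  ... | yes v≡s | yes v≡t = contradiction (trans (sym v≡s) v≡t) (source≢target e)
  ... | yes _   | no  _   = refl
  ... | no  _   | yes _   = refl
  ... | no  _   | no  _   = refl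

  -- Edges of a matching are disjoint, so at most one term is nonzero; its value is 1 because the
  -- two ends of an edge differ.
  covered≡∑ : ∀ {M} → Matching G M → ∀ v →
    ⟦ covered? M v ⟧ ≡ sum (λ e → ⟦ e ∈? M ⟧ *ℕ (⟦ v Fin.≟ source G e ⟧ +ℕ ⟦ v Fin.≟ target G e ⟧))
  covered≡∑ {M} matching v =
    trans (counted (covered? M v))
          (sum-cong-≗ λ e → cong (⟦ e ∈? M ⟧ *ℕ_) (sym (incident≡ends v e)))
    where
    open ≡-Reasoning
    term-zero : ∀ e → ¬ (e ∈ M × Incident G v e) → ⟦ e ∈? M ⟧ *ℕ ⟦ incident? G v e ⟧ ≡ 0
    term-zero e ¬both with e ∈? M
    ... | no  _   = refl
    ... | yes e∈M = cong (_+ℕ 0) (⟦⟧-false (incident? G v e) (λ ve → ¬both (e∈M , ve)))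

    counted : (c? : Dec (Covered M v)) → ⟦ c? ⟧ ≡ sum (λ e → ⟦ e ∈? M ⟧ *ℕ ⟦ incident? G v e ⟧)
    counted (no ¬c) = sym (sum-zero λ e → term-zero e (λ both → ¬c (e , both)))
    counted (yes (e , e∈M , ve)) = sym (begin
      sum (λ f → ⟦ f ∈? M ⟧ *ℕ ⟦ incident? G v f ⟧)
        ≡⟨ sum-single _ e (λ f f≢e → term-zero f λ (f∈M , vf) →
             matching f e f∈M e∈M f≢e v (vf , ve)) ⟩
      ⟦ e ∈? M ⟧ *ℕ ⟦ incident? G v e ⟧
        ≡⟨ cong₂ _*ℕ_ (⟦⟧-true (e ∈? M) e∈M) (⟦⟧-true (incident? G v e) ve) ⟩
      1 ∎)

  -- Each covered vertex is an end of exactly one edge of `M`, so the sum can be regrouped by edges: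
  -- expand the bracket, exchange the sums and evaluate at the two ends.
  ∑-covered : ∀ {M} → Matching G M → (f : Vector ℕ n) →
    ∑[ v < n ] (⟦ covered? M v ⟧ *ℕ f v) ≡ sum (λ e → ⟦ e ∈? M ⟧ *ℕ (f (source G e) +ℕ f (target G e)))
  ∑-covered {M} matching f = begin
    sum (λ v → ⟦ covered? M v ⟧ *ℕ f v)
      ≡⟨ sum-cong-≗ (λ v → trans (cong (_*ℕ f v) (covered≡∑ matching v)) (*-distribʳ-sum {length (edges G)} (f v) _)) ⟩
    sum (λ v → sum (λ e → ⟦ e ∈? M ⟧ *ℕ (⟦ v Fin.≟ source G e ⟧ +ℕ ⟦ v Fin.≟ target G e ⟧) *ℕ f v))
      ≡⟨ ∑-comm {n} {length (edges G)} _ ⟩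
    sum (λ e → sum (λ v → ⟦ e ∈? M ⟧ *ℕ (⟦ v Fin.≟ source G e ⟧ +ℕ ⟦ v Fin.≟ target G e ⟧) *ℕ f v))
      ≡⟨ sum-cong-≗ at-edge ⟩
    sum (λ e → ⟦ e ∈? M ⟧ *ℕ (f (source G e) +ℕ f (target G e)))
      ∎
    where
    open ≡-Reasoning
    δ : Fin n → Fin n → ℕ
    δ y v = ⟦ v Fin.≟ y ⟧

    at-edge : ∀ e →
      sum (λ v → ⟦ e ∈? M ⟧ *ℕ (δ (source G e) v +ℕ δ (target G e) v) *ℕ f v) ≡
      ⟦ e ∈? M ⟧ *ℕ (f (source G e) +ℕ f (target G e))
    at-edge e = begin
      sum (λ v → k *ℕ (δ s v +ℕ δ t v) *ℕ f v)                 ≡⟨ sum-cong-≗ (λ v → expand k (δ s v) (δ t v) (f v)) ⟩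
      sum (λ v → k *ℕ (δ s v *ℕ f v +ℕ δ t v *ℕ f v))          ≡⟨ sym (*-distribˡ-sum {n} k _) ⟩
      k *ℕ sum (λ v → δ s v *ℕ f v +ℕ δ t v *ℕ f v)            ≡⟨ cong (k *ℕ_) (∑-distrib-+ {n} _ _) ⟩
      k *ℕ (sum (λ v → δ s v *ℕ f v) +ℕ sum (λ v → δ t v *ℕ f v))
        ≡⟨ cong (k *ℕ_) (cong₂ _+ℕ_ (sum-indicator-single s f) (sum-indicator-single t f)) ⟩
      k *ℕ (f s +ℕ f t)                                        ∎
      where
      k = ⟦ e ∈? M ⟧
      s = source G e
      t = target G e
      expand : ∀ k a b c → k *ℕ (a +ℕ b) *ℕ c ≡ k *ℕ (a *ℕ c +ℕ b *ℕ c)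
      expand = solve-∀

  ∑-covered-const : ∀ {M} → Matching G M → ∀ c → ∑[ v < n ] (⟦ covered? M v ⟧ *ℕ c) ≡ ∣ M ∣ *ℕ (c +ℕ c)
  ∑-covered-const {M} matching c = begin
    sum (λ v → ⟦ covered? M v ⟧ *ℕ c)      ≡⟨ ∑-covered matching (λ _ → c) ⟩
    sum (λ e → ⟦ e ∈? M ⟧ *ℕ (c +ℕ c))     ≡⟨ sym (*-distribʳ-sum {length (edges G)} (c +ℕ c) _) ⟩
    sum (λ e → ⟦ e ∈? M ⟧) *ℕ (c +ℕ c)     ≡⟨ cong (_*ℕ (c +ℕ c)) (sym (∣p∣≡∑ M)) ⟩
    ∣ M ∣ *ℕ (c +ℕ c)                      ∎
    where open ≡-Reasoning

  -- Degree counts and the dominating set in a regular graph.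

  module _ {Δ} (regular : Regular G Δ) {M} (maximal : MaximalMatching G M) where

    ∑-covered-neighbours : ∀ {u} → ¬ Covered M u → ∑[ x < n ] (⟦ covered? M x ⟧ *ℕ ⟦ u ~? x ⟧) ≡ Δ
    ∑-covered-neighbours {u} ¬u = begin
      sum (λ x → ⟦ covered? M x ⟧ *ℕ ⟦ u ~? x ⟧) ≡⟨ sum-cong-≗ (λ x → pointwise x (u ~? x)) ⟩
      sum (λ x → ⟦ u ~? x ⟧)                     ≡⟨ sym (degree≡∑ u) ⟩
      degree G u                                 ≡⟨ regular u ⟩
      Δ                                          ∎
      where
      open ≡-Reasoning
      pointwise : ∀ x (u~?x : Dec (u ~ x)) → ⟦ covered? M x ⟧ *ℕ ⟦ u~?x ⟧ ≡ ⟦ u~?x ⟧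
      pointwise x (no _)    = ℕ.*-zeroʳ ⟦ covered? M x ⟧
      pointwise x (yes u~x) =
        cong (_*ℕ 1) (⟦⟧-true (covered? M x) (maximal⇒uncovered-independent maximal u~x ¬u))

    -- Regrouped by vertices, the exposure of `u` counts its covered neighbours. Every vertex that
    -- needs care thus has the same exponent.
    exposure-uncovered : ∀ {u} → ¬ Covered M u → exposure _~?_ M (source G) (target G) u ≡ Δ
    exposure-uncovered {u} ¬u = trans (sym (∑-covered (proj₁ maximal) _)) (∑-covered-neighbours ¬u)

    -- The partner `y` of `x` in the matching is a covered neighbour, so at least one of the `Δ`
    -- neighbours is missing from the count.
    ∑-uncovered-neighbours : ∀ {x} → Covered M x →
      ∑[ u < n ] (⟦ ¬? (covered? M u) ⟧ *ℕ ⟦ u ~? x ⟧) ≤ℕ Δ ∸ 1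
    ∑-uncovered-neighbours {x} x-covered with y , y-covered , x~y ← covered-partner x-covered =
      ℕ.m+n≤o⇒m≤o∸n _ (begin
        sum (λ u → ⟦ ¬? (covered? M u) ⟧ *ℕ ⟦ u ~? x ⟧) +ℕ 1
          -- The 1 is written as a sum of indicators of `y`, so that the comparison with the degree
          -- becomes pointwise.
          ≡⟨ cong (sum {n} _ +ℕ_) (sym (sum-indicator-single y (λ _ → 1))) ⟩
        sum (λ u → ⟦ ¬? (covered? M u) ⟧ *ℕ ⟦ u ~? x ⟧) +ℕ sum (λ u → ⟦ u Fin.≟ y ⟧ *ℕ 1)
          ≡⟨ sym (∑-distrib-+ {n} _ _) ⟩
        sum (λ u → ⟦ ¬? (covered? M u) ⟧ *ℕ ⟦ u ~? x ⟧ +ℕ ⟦ u Fin.≟ y ⟧ *ℕ 1)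
          ≤⟨ sum-mono-≤ (λ u → pointwise u (covered? M u) (u Fin.≟ y)) ⟩
        sum (λ u → ⟦ x ~? u ⟧)
          ≡⟨ trans (sym (degree≡∑ x)) (regular x) ⟩
        Δ ∎)
      where
      open ℕ.≤-Reasoning
      pointwise : ∀ u (c? : Dec (Covered M u)) (u≟y : Dec (u ≡ y)) →
        ⟦ ¬? c? ⟧ *ℕ ⟦ u ~? x ⟧ +ℕ ⟦ u≟y ⟧ *ℕ 1 ≤ℕ ⟦ x ~? u ⟧
      pointwise u (no ¬c) (yes refl) = contradiction y-covered ¬c
      pointwise u (yes _) (yes refl) = ℕ.≤-reflexive (sym (⟦⟧-true (x ~? u) x~y))
      pointwise u (yes _) (no _)     = z≤n
      pointwise u (no _)  (no _)     = ℕ.≤-trans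
        (ℕ.≤-reflexive (trans (ℕ.+-identityʳ _) (ℕ.*-identityˡ _)))
        (⟦⟧-mono (u ~? x) (x ~? u) ~-sym)

    -- Double counting of adjacent pairs of an uncovered `u` and a covered `x`: each `u` lies in `Δ`
    -- pairs, and each of the `2 * ∣ M ∣` covered `x` in at most `Δ ∸ 1`.
    ∣uncovered∣-bound : Δ *ℕ ∣ uncovered M ∣ ≤ℕ 2 *ℕ (Δ ∸ 1) *ℕ ∣ M ∣
    ∣uncovered∣-bound = begin
      Δ *ℕ ∣ uncovered M ∣
        ≡⟨ cong (Δ *ℕ_) (∣comprehension∣≡∑ (λ v → ¬? (covered? M v))) ⟩
      Δ *ℕ sum (λ u → ⟦ ¬? (covered? M u) ⟧)
        ≡⟨ *-distribˡ-sum {n} Δ _ ⟩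
      sum (λ u → Δ *ℕ ⟦ ¬? (covered? M u) ⟧)
        ≡⟨ sum-cong-≗ (λ u → at-uncovered u (covered? M u)) ⟩
      sum (λ u → sum (λ x → ⟦ ¬? (covered? M u) ⟧ *ℕ (⟦ covered? M x ⟧ *ℕ ⟦ u ~? x ⟧)))
        ≡⟨ ∑-comm {n} {n} _ ⟩
      sum (λ x → sum (λ u → ⟦ ¬? (covered? M u) ⟧ *ℕ (⟦ covered? M x ⟧ *ℕ ⟦ u ~? x ⟧)))
        ≤⟨ sum-mono-≤ (λ x → at-covered x (covered? M x)) ⟩
      sum (λ x → ⟦ covered? M x ⟧ *ℕ (Δ ∸ 1))
        ≡⟨ ∑-covered-const (proj₁ maximal) (Δ ∸ 1) ⟩
      ∣ M ∣ *ℕ ((Δ ∸ 1) +ℕ (Δ ∸ 1))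
        ≡⟨ rearrange ∣ M ∣ (Δ ∸ 1) ⟩
      2 *ℕ (Δ ∸ 1) *ℕ ∣ M ∣ ∎
      where
      open ℕ.≤-Reasoning
      rearrange : ∀ k c → k *ℕ (c +ℕ c) ≡ 2 *ℕ c *ℕ k
      rearrange = solve-∀

      at-uncovered : ∀ u (c? : Dec (Covered M u)) →
        Δ *ℕ ⟦ ¬? c? ⟧ ≡ sum (λ x → ⟦ ¬? c? ⟧ *ℕ (⟦ covered? M x ⟧ *ℕ ⟦ u ~? x ⟧))
      at-uncovered u (yes _) = trans (ℕ.*-zeroʳ Δ) (sym (sum-zero {n} λ _ → refl))
      at-uncovered u (no ¬u) = trans (ℕ.*-comm Δ 1)
        (trans (cong (1 *ℕ_) (sym (∑-covered-neighbours ¬u))) (*-distribˡ-sum {n} 1 _))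

      at-covered : ∀ x (c? : Dec (Covered M x)) →
        sum (λ u → ⟦ ¬? (covered? M u) ⟧ *ℕ (⟦ c? ⟧ *ℕ ⟦ u ~? x ⟧)) ≤ℕ ⟦ c? ⟧ *ℕ (Δ ∸ 1)
      at-covered x (no _)  = ℕ.≤-reflexive (sum-zero λ u → ℕ.*-zeroʳ ⟦ ¬? (covered? M u) ⟧)
      at-covered x (yes c) = begin
        sum (λ u → ⟦ ¬? (covered? M u) ⟧ *ℕ (1 *ℕ ⟦ u ~? x ⟧))
          ≡⟨ sum-cong-≗ (λ u → cong (⟦ ¬? (covered? M u) ⟧ *ℕ_) (ℕ.*-identityˡ _)) ⟩
        sum (λ u → ⟦ ¬? (covered? M u) ⟧ *ℕ ⟦ u ~? x ⟧)
          ≤⟨ ∑-uncovered-neighbours c ⟩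
        Δ ∸ 1
          ≡⟨ sym (ℕ.*-identityˡ _) ⟩
        1 *ℕ (Δ ∸ 1) ∎

    -- `D` consists of the chosen ends `C` and the set `X` of vertices they miss. The factor `2 ^ Δ`
    -- clears the denominator of the escape probability.
    dominating-from-matching : ∃ λ D → Dominating G D × 2 ^ Δ *ℕ ∣ D ∣ ≤ℕ 2 ^ Δ *ℕ ∣ M ∣ +ℕ ∣ uncovered M ∣
    dominating-from-matching
      with C , ∣C∣≤∣M∣ , hits , bound ←
             -- Weight 1 goes to uncovered vertices only, which makes the initial total equal to
             -- `∣ uncovered M ∣`.
             choose-endpoints _~?_ M (source G) (target G) (λ u → ⟦ u ∈? uncovered M ⟧) =
      C ∪ X , dominating , (begin
        2 ^ Δ *ℕ ∣ C ∪ X ∣                     ≤⟨ ℕ.*-monoʳ-≤ (2 ^ Δ) (∣p∪q∣≤∣p∣+∣q∣ C X) ⟩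
        2 ^ Δ *ℕ (∣ C ∣ +ℕ ∣ X ∣)              ≡⟨ ℕ.*-distribˡ-+ (2 ^ Δ) ∣ C ∣ ∣ X ∣ ⟩
        2 ^ Δ *ℕ ∣ C ∣ +ℕ 2 ^ Δ *ℕ ∣ X ∣       ≤⟨ ℕ.+-mono-≤ (ℕ.*-monoʳ-≤ (2 ^ Δ) ∣C∣≤∣M∣) X-bound ⟩
        2 ^ Δ *ℕ ∣ M ∣ +ℕ ∣ uncovered M ∣      ∎)
      where
      open ℕ.≤-Reasoning
      hit? : ∀ v → Dec (∃ λ x → x ∈ C × v ~ x)
      hit? v = Fin.any? λ x → (x ∈? C) ×-dec (v ~? x)

      undominated? : ∀ v → Dec (¬ Covered M v × ¬ ∃ λ x → x ∈ C × v ~ x)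
      undominated? v = ¬? (covered? M v) ×-dec ¬? (hit? v)

      X : Subset n
      X = comprehension undominated?

      X-undominated : Undominated _~?_ C X
      X-undominated u x u∈X x∈C u~x = proj₂ (∈-comprehension⁻ undominated? u∈X) (x , x∈C , u~x)

      -- Each vertex of `X` starts with weight 1 and has exposure `Δ`, so it ends with weight
      -- `2 ^ Δ`.
      X-bound : 2 ^ Δ *ℕ ∣ X ∣ ≤ℕ ∣ uncovered M ∣
      X-bound = begin
        2 ^ Δ *ℕ ∣ X ∣
          ≡⟨ cong (2 ^ Δ *ℕ_) (∣p∣≡∑ X) ⟩
        2 ^ Δ *ℕ sum (λ u → ⟦ u ∈? X ⟧)
          ≡⟨ *-distribˡ-sum {n} (2 ^ Δ) _ ⟩
        sum (λ u → 2 ^ Δ *ℕ ⟦ u ∈? X ⟧)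
          ≡⟨ sum-cong-≗ (λ u → pointwise u (u ∈? X)) ⟩
        undominated-weight _~?_ X (λ u → ⟦ u ∈? uncovered M ⟧) (exposure _~?_ M (source G) (target G))
          ≤⟨ bound X X-undominated ⟩
        sum (λ u → ⟦ u ∈? uncovered M ⟧)
          ≡⟨ sym (∣p∣≡∑ (uncovered M)) ⟩
        ∣ uncovered M ∣ ∎
        where
        pointwise : ∀ u (u∈?X : Dec (u ∈ X)) → 2 ^ Δ *ℕ ⟦ u∈?X ⟧ ≡
          ⟦ u∈?X ⟧ *ℕ (⟦ u ∈? uncovered M ⟧ *ℕ 2 ^ exposure _~?_ M (source G) (target G) u)
        pointwise u (no _)    = ℕ.*-zeroʳ (2 ^ Δ)
        pointwise u (yes u∈X)
          with ¬u , _ ← ∈-comprehension⁻ undominated? u∈X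
          rewrite exposure-uncovered ¬u
                | ⟦⟧-true (u ∈? uncovered M) (∈-comprehension⁺ (λ v → ¬? (covered? M v)) ¬u) =
          trans (ℕ.*-comm (2 ^ Δ) 1) (cong (1 *ℕ_) (sym (ℕ.*-identityˡ _)))

      dominates-covered : ∀ {v} → Covered M v → v ∉ C → ∃ λ x → x ∈ C × v ~ x
      dominates-covered (e , e∈M , inj₁ refl) v∉C with hits e e∈M
      ... | inj₁ s∈C = contradiction s∈C v∉C
      ... | inj₂ t∈C = target G e , t∈C , source~target e
      dominates-covered (e , e∈M , inj₂ refl) v∉C with hits e e∈M
      ... | inj₁ s∈C = source G e , s∈C , ~-sym (source~target e)
      ... | inj₂ t∈C = contradiction t∈C v∉C

      neighbour-in-C : ∀ v → v ∉ C → v ∉ X → ∃ λ x → x ∈ C × v ~ x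
      neighbour-in-C v v∉C v∉X with covered? M v | hit? v
      ... | yes v-covered | _       = dominates-covered v-covered v∉C
      ... | no _          | yes hit = hit
      ... | no ¬v         | no ¬hit = contradiction (∈-comprehension⁺ undominated? (¬v , ¬hit)) v∉X

      dominating : Dominating G (C ∪ X)
      dominating v v∉ with x , x∈C , v~x ← neighbour-in-C v (v∉ ∘ p⊆p∪q X) (v∉ ∘ q⊆p∪q C X) =
        x , p⊆p∪q X x∈C , v~x

  -- The final inequality, in the naturals and then in the rationals.

  γ-bound : ∀ {Δ} → Regular G Δ →
    Δ *ℕ 2 ^ Δ *ℕ γ G ≤ℕ (Δ *ℕ 2 ^ Δ +ℕ 2 *ℕ (Δ ∸ 1)) *ℕ γₑ G
  γ-bound {Δ} regular
    -- This abstraction turns `γₑ G` in the goal into `∣ M ∣`.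
    with M , maximal , _ ← minimumMaximalMatching G
    with D , dominating , ∣D∣-bound ← dominating-from-matching regular maximal = begin
      Δ *ℕ 2 ^ Δ *ℕ γ G                                  ≤⟨ ℕ.*-monoʳ-≤ (Δ *ℕ 2 ^ Δ) (γ-minimum D dominating) ⟩
      Δ *ℕ 2 ^ Δ *ℕ ∣ D ∣                                ≡⟨ ℕ.*-assoc Δ (2 ^ Δ) ∣ D ∣ ⟩
      Δ *ℕ (2 ^ Δ *ℕ ∣ D ∣)                              ≤⟨ ℕ.*-monoʳ-≤ Δ ∣D∣-bound ⟩
      Δ *ℕ (2 ^ Δ *ℕ ∣ M ∣ +ℕ ∣ uncovered M ∣)           ≡⟨ expand Δ (2 ^ Δ) ∣ M ∣ ∣ uncovered M ∣ ⟩
      Δ *ℕ 2 ^ Δ *ℕ ∣ M ∣ +ℕ Δ *ℕ ∣ uncovered M ∣        ≤⟨ ℕ.+-monoʳ-≤ _ (∣uncovered∣-bound regular maximal) ⟩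
      Δ *ℕ 2 ^ Δ *ℕ ∣ M ∣ +ℕ 2 *ℕ (Δ ∸ 1) *ℕ ∣ M ∣       ≡⟨ sym (ℕ.*-distribʳ-+ ∣ M ∣ (Δ *ℕ 2 ^ Δ) _) ⟩
      (Δ *ℕ 2 ^ Δ +ℕ 2 *ℕ (Δ ∸ 1)) *ℕ ∣ M ∣              ∎
    where
    open ℕ.≤-Reasoning
    expand : ∀ a b c d → a *ℕ (b *ℕ c +ℕ d) ≡ a *ℕ b *ℕ c +ℕ a *ℕ d
    expand = solve-∀

-- Unnormalised fractions are compared by cross multiplication, so both sides are carried there,
-- where the claim is an inequality of integers.
≤-from-ℕ : ∀ p q .{{_ : NonZero q}} g h → q *ℕ g ≤ℕ (q +ℕ p) *ℕ h →
           + g / 1 ≤ (1ℚ + + p / q) * (+ h / 1)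
≤-from-ℕ p q@(suc _) g h qg≤ = ℚ.toℚᵘ-cancel-≤ (begin
  toℚᵘ (+ g / 1)
    ≃⟨ ℚ.toℚᵘ-fromℚᵘ (+ g ℚᵘ./ 1) ⟩
  + g ℚᵘ./ 1
    ≤⟨ ℚᵘ.*≤* cross ⟩
  (ℚᵘ.1ℚᵘ ℚᵘ.+ + p ℚᵘ./ q) ℚᵘ.* (+ h ℚᵘ./ 1)
    ≃⟨ ℚᵘ.*-cong (ℚᵘ.+-congʳ ℚᵘ.1ℚᵘ (ℚ.toℚᵘ-fromℚᵘ (+ p ℚᵘ./ q))) (ℚ.toℚᵘ-fromℚᵘ (+ h ℚᵘ./ 1)) ⟨
  (ℚᵘ.1ℚᵘ ℚᵘ.+ toℚᵘ (+ p / q)) ℚᵘ.* toℚᵘ (+ h / 1)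
    ≃⟨ ℚᵘ.*-congʳ (ℚ.toℚᵘ-homo-+ 1ℚ (+ p / q)) ⟨
  toℚᵘ (1ℚ + + p / q) ℚᵘ.* toℚᵘ (+ h / 1)
    ≃⟨ ℚ.toℚᵘ-homo-* (1ℚ + + p / q) (+ h / 1) ⟨
  toℚᵘ ((1ℚ + + p / q) * (+ h / 1))
    ∎)
  where
  open ℚᵘ.≤-Reasoning
  numerator : + ((q +ℕ p) *ℕ h) ≡ (+ 1 ℤ.* + q ℤ.+ + p ℤ.* + 1) ℤ.* + h ℤ.* + 1
  numerator = trans (ℤ.pos-* (q +ℕ p) h) (sym (trans (ℤ.*-identityʳ _)
    (cong (ℤ._* + h) (cong₂ ℤ._+_ (ℤ.*-identityˡ (+ q)) (ℤ.*-identityʳ (+ p))))))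

  -- The factors 1 come from unnormalised arithmetic: the right side has denominator `1 * q * 1`,
  -- the left side 1.
  cross : + g ℤ.* + (1 *ℕ q *ℕ 1) ℤ.≤ (+ 1 ℤ.* + q ℤ.+ + p ℤ.* + 1) ℤ.* + h ℤ.* + 1
  cross = subst₂ ℤ._≤_
    (trans (cong +_ (trans (ℕ.*-comm q g) (cong (g *ℕ_) (sym (trans (ℕ.*-identityʳ _) (ℕ.*-identityˡ q))))))
           (ℤ.pos-* g (1 *ℕ q *ℕ 1)))
    numerator
    (ℤ.+≤+ qg≤)

theorem1 : ∀ (Δ : ℕ) .{{_ : NonZero Δ}} {n : ℕ} (G : Graph n) → Regular G Δ →
    + γ G / 1 ≤ (1ℚ + + (2 *ℕ (Δ ∸ 1)) / (Δ *ℕ 2 ^ Δ)) * (+ γₑ G / 1)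
theorem1 Δ G regular =
  ≤-from-ℕ (2 *ℕ (Δ ∸ 1)) (Δ *ℕ 2 ^ Δ) (γ G) (γₑ G) (γ-bound G regular)
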